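{- For every constant $\varepsilon > 0$, no (possibly randomized) online algorithm that uses no preemption is $(1/4+\varepsilon)$-competitive for online unconstrained submodular maximization, even if the objective function $f$ is guaranteed to be the cut function of a weighted directed graph.
   Context: Online unconstrained submodular maximization: there is an unknown finite ground set $\mathcal N=\{u_1,\dots,u_n\}$ and a non-negative submodular function $f:2^{\mathcal N}\to\mathbb R_{\ge 0}$. The elements are revealed one by one in the order $u_1,u_2,\dots,u_n$, chosen by an adversary. The algorithm does not know $n$ in advance. The algorithm maintains solutions $S_0=\varnothing,S_1,\dots,S_n$, where $S_i\subseteq S_{i-1}\cup\{u_i\}$ is chosen (possibly at random) immediately after $u_i$ is revealed, using only the values of $f$ on subsets of $\mathcal N_i=\{u_1,\dots,u_i\}$ (accessed through a value oracle), the past, and internal randomness. There is no restriction on the computational power of the algorithm. Every subset of $\mathcal N$ is feasible. The algorithm uses no preemption if it never removes an accepted element, i.e. $S_{i-1}\subseteq S_i$ for every $i$ (so $S_i\in\{S_{i-1},S_{i-1}\cup\{u_i\}\}$). The algorithm is $\alpha$-competitive if $\mathbb E[f(S_n)]\ge \alpha\cdot\max_{S\subseteq\mathcal N}f(S)$ for every instance. The cut function of a directed graph with vertex set $\mathcal N$ and non-negative arc weights is $f(S)=$ the total weight of arcs going from a vertex of $S$ to a vertex of $\mathcal N\setminus S$. -}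

module Defs where

open import Level using (Level; suc; _⊔_)
open import Algebra.Bundles using (CommutativeRing; RawMonoid)
import Algebra.Construct.NaturalChoice.Max as Max
import Algebra.Definitions.RawMonoid as RawMonoidDefs
import Algebra.Properties.Monoid.Sum as Sum
open import Data.Bool using (Bool; true; false; not; _∧_; _∨_; if_then_else_)
import Data.Bool.Properties as Bool
open import Data.Fin using (Fin)
open import Data.Fin.Subset using (Subset; inside; outside; _⊆_; _∪_; _∩_)
open import Data.Nat as ℕ using (ℕ)
open import Data.Product using (∃-syntax; _×_)
open import Data.Vec using ([]; _∷ʳ_; lookup)
import Data.Vec.Properties as Vec
open import Relation.Binary using (Rel; IsTotalOrder; TotalOrder)
import Relation.Binary.Construct.NonStrictToStrict as Strict
open import Relation.Binary.PropositionalEquality using (_≡_; _≗_)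
open import Relation.Nullary using (¬_; does)

-- The library has no real numbers. Function values, arc weights,
-- probabilities and competitive ratios live in an arbitrary Archimedean
-- totally ordered field; ℝ is one, so results quantified over all such
-- fields include the real case.
record ArchimedeanOrderedField (c ℓ₁ ℓ₂ : Level) : Set (suc (c ⊔ ℓ₁ ⊔ ℓ₂)) where
  infix 8 _⁻¹
  infix 4 _≤_
  field
    commutativeRing : CommutativeRing c ℓ₁
  open CommutativeRing commutativeRing public
  open RawMonoidDefs +-rawMonoid public using () renaming (_×_ to _·_)
  field
    _≤_          : Rel Carrier ℓ₂
    isTotalOrder : IsTotalOrder _≈_ _≤_
    +-monoʳ-≤    : ∀ x {y z} → y ≤ z → x + y ≤ x + z
    *-nonneg     : ∀ {x y} → 0# ≤ x → 0# ≤ y → 0# ≤ x * y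
    0≉1          : ¬ 0# ≈ 1#
    -- total, with an unspecified value at 0#
    _⁻¹          : Carrier → Carrier
    *-inverseʳ   : ∀ x → ¬ x ≈ 0# → x * x ⁻¹ ≈ 1#
    archimedean  : ∀ x → ∃[ n ] x ≤ n · 1#

  totalOrder : TotalOrder c ℓ₁ ℓ₂
  totalOrder = record { isTotalOrder = isTotalOrder }

  open Strict _≈_ _≤_ public using (_<_)
  open Max totalOrder public using () renaming (_⊔_ to max)
  open Sum +-monoid public using (sum-syntax)

  ¼ : Carrier
  ¼ = (4 · 1#) ⁻¹

module OnlineUSM {c ℓ₁ ℓ₂} (K : ArchimedeanOrderedField c ℓ₁ ℓ₂) where
  open ArchimedeanOrderedField K

  -- Events are given by their indicator functions. Only finite additivity is
  -- imposed, so every (countably additive) probability space is an instance.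
  record ProbabilitySpace (o e : Level) : Set (c ⊔ ℓ₁ ⊔ ℓ₂ ⊔ suc (o ⊔ e)) where
    field
      Sample     : Set o
      Event      : (Sample → Bool) → Set e
      Event-resp : ∀ {A B} → A ≗ B → Event A → Event B
      Event-all  : Event (λ _ → true)
      Event-not  : ∀ {A} → Event A → Event (λ ω → not (A ω))
      Event-∨    : ∀ {A B} → Event A → Event B → Event (λ ω → A ω ∨ B ω)
      -- the values of Pr outside Event are irrelevant
      Pr         : (Sample → Bool) → Carrier
      Pr-cong    : ∀ {A B} → Event A → A ≗ B → Pr A ≈ Pr B
      Pr-nonneg  : ∀ {A} → Event A → 0# ≤ Pr A
      Pr-all     : Pr (λ _ → true) ≈ 1#
      Pr-∨       : ∀ {A B} → Event A → Event B → (∀ ω → A ω ∧ B ω ≡ false) →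
                   Pr (λ ω → A ω ∨ B ω) ≈ Pr A + Pr B

  -- The ground set {u₁,…,uₙ} is Fin n in order of arrival, so T ∷ʳ outside is
  -- T ⊆ {u₁,…,uₙ} viewed inside {u₁,…,uₙ₊₁}, and T ∷ʳ inside is T ∪ {uₙ₊₁}.
  SetFunction : ℕ → Set c
  SetFunction n = Subset n → Carrier

  NonNegative : ∀ {n} → SetFunction n → Set ℓ₂
  NonNegative f = ∀ S → 0# ≤ f S

  Submodular : ∀ {n} → SetFunction n → Set ℓ₂
  Submodular f = ∀ S T → f (S ∪ T) + f (S ∩ T) ≤ f S + f T

  cut : ∀ {n} → (Fin n → Fin n → Carrier) → SetFunction n
  cut {n} w S = ∑[ i < n ] ∑[ j < n ]
    (if lookup S i ∧ not (lookup S j) then w i j else 0#)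

  IsDirectedCut : ∀ {n} → SetFunction n → Set (c ⊔ ℓ₁ ⊔ ℓ₂)
  IsDirectedCut {n} f = ∃[ w ] ((∀ (i j : Fin n) → 0# ≤ w i j) × (∀ S → f S ≈ cut w S))

  fold⊆ : (Carrier → Carrier → Carrier) → ∀ {n} → SetFunction n → Carrier
  fold⊆ _∙_ {ℕ.zero}  f = f []
  fold⊆ _∙_ {ℕ.suc n} f = fold⊆ _∙_ (λ T → f (T ∷ʳ outside)) ∙ fold⊆ _∙_ (λ T → f (T ∷ʳ inside))

  ∑⊆ max⊆ : ∀ {n} → SetFunction n → Carrier
  ∑⊆   = fold⊆ _+_
  max⊆ = fold⊆ max

  restrict : ∀ {n} → SetFunction (ℕ.suc n) → SetFunction n
  restrict f T = f (T ∷ʳ outside)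

  -- solution ω i g is the set Sᵢ held right after the arrival of uᵢ, where ω is
  -- the internal randomness and g the restriction of the objective to subsets
  -- of {u₁,…,uᵢ}. The number of elements still to come is not an argument. The
  -- past is determined by ω and g: the earlier oracles are restrictions of g.
  record OnlineAlgorithm {o e} (Ω : ProbabilitySpace o e) : Set (c ⊔ ℓ₁ ⊔ o ⊔ e) where
    open ProbabilitySpace Ω
    field
      solution   : Sample → (i : ℕ) → SetFunction i → Subset i
      cong       : ∀ ω i {g h : SetFunction i} → (∀ T → g T ≈ h T) →
                   solution ω i g ≡ solution ω i h
      feasible   : ∀ ω i (g : SetFunction (ℕ.suc i)) →
                   solution ω (ℕ.suc i) g ⊆ solution ω i (restrict g) ∷ʳ inside

    _ends-with_on_ : ∀ {i} → Sample → Subset i → SetFunction i → Bool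
    _ends-with_on_ {i} ω T g = does (Vec.≡-dec Bool._≟_ (solution ω i g) T)

    field
      measurable : ∀ {i} (g : SetFunction i) T → Event (λ ω → ω ends-with T on g)

    -- 𝔼[ f(Sₙ) ]
    expectedValue : ∀ {n} → SetFunction n → Carrier
    expectedValue f = ∑⊆ (λ T → Pr (λ ω → ω ends-with T on f) * f T)

  module _ {o e} {Ω : ProbabilitySpace o e} (A : OnlineAlgorithm Ω) where
    open ProbabilitySpace Ω
    open OnlineAlgorithm A

    NoPreemption : Set (c ⊔ o)
    NoPreemption = ∀ ω i (g : SetFunction (ℕ.suc i)) →
      solution ω i (restrict g) ∷ʳ outside ⊆ solution ω (ℕ.suc i) g

    -- α-competitive on the instances whose objective is in the class 𝓕
    Competitive : ∀ {ℓ} → Carrier → (∀ {n} → SetFunction n → Set ℓ) → Set (c ⊔ ℓ₂ ⊔ ℓ)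
    Competitive α 𝓕 = ∀ n (f : SetFunction n) → 𝓕 f → α * max⊆ f ≤ expectedValue f

{-# OPTIONS --safe #-}

-- Fix 0 < η ≤ 1 with 2η ≤ ε and let M = 1 + 1/η. Vertex k + 1 sends arcs of total
-- weight Mᵏ to the earlier vertices, distributed as an exponential moving average
-- of rate η. Let Q be the share of that average lying on rejected vertices.
-- Accepting vertex k + 1 gains Mᵏ Q, all earlier arcs together gain at most η Mᵏ,
-- and the optimum is at least Mᵏ, so competitiveness forces 𝔼[X Q] ≥ ¼ + η, where
-- X is the indicator of acceptance. The update Q ↦ (1 − η) Q + η (1 − X) changes Q²
-- by at most 2η (Q (1 − Q) − X Q) + η², and Q (1 − Q) ≤ ¼, so 𝔼[Q²] drops by at
-- least η² at every step, which is impossible because 0 ≤ Q ≤ 1.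
module Submission where

open import Defs
open import Data.Product using (_×_)
open import Relation.Nullary using (¬_)

open import Algebra.Construct.NaturalChoice.Max using (maxOperator)
import Algebra.Construct.NaturalChoice.MaxOp as MaxOp
import Algebra.Properties.CommutativeMonoid.Sum as CommutativeMonoidSum
import Algebra.Properties.Ring as RingProperties
import Algebra.Properties.Semiring.Exp as SemiringExp
import Algebra.Properties.Semiring.Sum as SemiringSum
import Algebra.Solver.Ring.NaturalCoefficients.Default as NaturalCoefficients
open import Data.Bool using (Bool; true; false; not; _∧_; _∨_; if_then_else_)
import Data.Bool.Properties as Bool
open import Data.Empty using (⊥; ⊥-elim)
open import Data.Fin using (Fin; zero; suc; toℕ; fromℕ; inject₁)
import Data.Fin.Properties as Fin
open import Data.Fin.Subset using (Subset; inside; outside; _∈_; _⊆_; _∪_; _∩_)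
open import Data.Fin.Subset.Properties using (⊆-antisym)
open import Data.Nat as ℕ using (ℕ)
import Data.Nat.Properties as ℕ
open import Data.Product using (_,_; ∃-syntax; proj₁; proj₂)
open import Data.Sum using (_⊎_; inj₁; inj₂)
open import Data.Vec using ([]; _∷_; _∷ʳ_; here; there; initLast; lookup)
import Data.Vec.Properties as Vec
open import Function.Bundles using (mk⇔)
open import Relation.Binary.Bundles using (TotalOrder)
import Relation.Binary.PropositionalEquality as ≡
open ≡ using (_≡_)
open import Relation.Nullary using (Dec; does; contradiction)
open import Relation.Nullary.Decidable using (dec-true; dec-false; does-⇔; _×-dec_; _⊎-dec_)

-- Inequalities in an ordered field, up to the one-step drift of the squared average.

module OrderedFieldProperties {c ℓ₁ ℓ₂} (K : ArchimedeanOrderedField c ℓ₁ ℓ₂) where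
  open ArchimedeanOrderedField K hiding (zero)
  open TotalOrder totalOrder public using (poset; total)
    renaming (reflexive to ≤-reflexive; trans to ≤-trans; refl to ≤-refl; antisym to ≤-antisym)
  open import Relation.Binary.Reasoning.PartialOrder poset
  open NaturalCoefficients commutativeSemiring using (solve; _:=_; _:+_; _:*_)
  open RingProperties ring using (-‿distribˡ-*; -‿involutive)

  +-monoˡ-≤ : ∀ x {y z} → y ≤ z → y + x ≤ z + x
  +-monoˡ-≤ x {y} {z} y≤z = begin
    y + x  ≈⟨ +-comm y x ⟩
    x + y  ≤⟨ +-monoʳ-≤ x y≤z ⟩
    x + z  ≈⟨ +-comm x z ⟩
    z + x  ∎

  +-mono-≤ : ∀ {x y u v} → x ≤ y → u ≤ v → x + u ≤ y + v
  +-mono-≤ {x} {y} {u} {v} x≤y u≤v = ≤-trans (+-monoˡ-≤ u x≤y) (+-monoʳ-≤ y u≤v)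

  +-nonneg : ∀ {x y} → 0# ≤ x → 0# ≤ y → 0# ≤ x + y
  +-nonneg 0≤x 0≤y = ≤-trans (≤-reflexive (sym (+-identityʳ 0#))) (+-mono-≤ 0≤x 0≤y)

  x≤x+y : ∀ {x y} → 0# ≤ y → x ≤ x + y
  x≤x+y {x} 0≤y = ≤-trans (≤-reflexive (sym (+-identityʳ x))) (+-monoʳ-≤ x 0≤y)

  +-cancelʳ-≤ : ∀ z {x y} → x + z ≤ y + z → x ≤ y
  +-cancelʳ-≤ z {x} {y} x+z≤y+z = begin
    x                ≈⟨ undo x ⟨
    (x + z) + - z    ≤⟨ +-monoˡ-≤ (- z) x+z≤y+z ⟩
    (y + z) + - z    ≈⟨ undo y ⟩
    y                ∎
    where
    undo : ∀ w → (w + z) + - z ≈ w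
    undo w = trans (+-assoc w z (- z)) (trans (+-congˡ (-‿inverseʳ z)) (+-identityʳ w))

  -- Trades an inequality for an equation with a nonnegative remainder, so that later identities
  -- contain no subtraction and the semiring solver applies to them.
  ≤⇒difference : ∀ {x y} → x ≤ y → ∃[ d ] (0# ≤ d × y ≈ x + d)
  ≤⇒difference {x} {y} x≤y = (y + - x) , 0≤d , y≈x+d
    where
    0≤d : 0# ≤ y + - x
    0≤d = ≤-trans (≤-reflexive (sym (-‿inverseʳ x))) (+-monoˡ-≤ (- x) x≤y)
    y≈x+d : y ≈ x + (y + - x)
    y≈x+d = sym (trans (+-comm x _) (trans (+-assoc y (- x) x)
              (trans (+-congˡ (-‿inverseˡ x)) (+-identityʳ y))))

  *-monoʳ-≤ : ∀ {x} → 0# ≤ x → ∀ {y z} → y ≤ z → x * y ≤ x * z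
  *-monoʳ-≤ {x} 0≤x {y} {z} y≤z with ≤⇒difference y≤z
  ... | d , 0≤d , z≈y+d = begin
    x * y          ≤⟨ x≤x+y (*-nonneg 0≤x 0≤d) ⟩
    x * y + x * d  ≈⟨ distribˡ x y d ⟨
    x * (y + d)    ≈⟨ *-congˡ z≈y+d ⟨
    x * z          ∎

  *-monoˡ-≤ : ∀ {x} → 0# ≤ x → ∀ {y z} → y ≤ z → y * x ≤ z * x
  *-monoˡ-≤ {x} 0≤x {y} {z} y≤z = begin
    y * x  ≈⟨ *-comm y x ⟩
    x * y  ≤⟨ *-monoʳ-≤ 0≤x y≤z ⟩
    x * z  ≈⟨ *-comm x z ⟩
    z * x  ∎

  0≤1 : 0# ≤ 1#
  0≤1 with total 0# 1#
  ... | inj₁ p = p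
  ... | inj₂ 1≤0 = ≤-trans (*-nonneg 0≤-1 0≤-1) (≤-reflexive -1*-1≈1)
    where
    0≤-1 : 0# ≤ - 1#
    0≤-1 = begin
      0#          ≈⟨ -‿inverseʳ 1# ⟨
      1# + - 1#   ≤⟨ +-monoˡ-≤ (- 1#) 1≤0 ⟩
      0# + - 1#   ≈⟨ +-identityˡ _ ⟩
      - 1#        ∎
    -1*-1≈1 : - 1# * - 1# ≈ 1#
    -1*-1≈1 = begin-equality
      - 1# * - 1#    ≈⟨ -‿distribˡ-* 1# (- 1#) ⟨
      - (1# * - 1#)  ≈⟨ -‿cong (*-identityˡ _) ⟩
      - - 1#         ≈⟨ -‿involutive 1# ⟩
      1#             ∎

  1≰0 : ¬ 1# ≤ 0#
  1≰0 1≤0 = 0≉1 (≤-antisym 0≤1 1≤0)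

  ⁻¹-nonneg : ∀ {x} → 0# ≤ x → ¬ x ≈ 0# → 0# ≤ x ⁻¹
  ⁻¹-nonneg {x} 0≤x x≉0 with total 0# (x ⁻¹)
  ... | inj₁ p = p
  ... | inj₂ x⁻¹≤0 = ⊥-elim (1≰0 (begin
    1#         ≈⟨ *-inverseʳ x x≉0 ⟨
    x * x ⁻¹   ≤⟨ *-monoʳ-≤ 0≤x x⁻¹≤0 ⟩
    x * 0#     ≈⟨ zeroʳ x ⟩
    0#         ∎))

  -- If `z ≤ y`, write `y ≈ z + d`. The assumption leaves `x * d ≤ 0#`, and `1# ≤ x` gives
  -- `d ≤ x * d`, hence `d ≤ 0#`.
  *-cancelˡ-≤ : ∀ {x} → 1# ≤ x → ∀ {y z} → x * y ≤ x * z → y ≤ z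
  *-cancelˡ-≤ {x} 1≤x {y} {z} xy≤xz with total y z
  ... | inj₁ y≤z = y≤z
  ... | inj₂ z≤y with ≤⇒difference z≤y
  ... | d , 0≤d , y≈z+d = begin
    y       ≈⟨ y≈z+d ⟩
    z + d   ≤⟨ +-monoʳ-≤ z d≤0 ⟩
    z + 0#  ≈⟨ +-identityʳ z ⟩
    z       ∎
    where
    d≤0 : d ≤ 0#
    d≤0 = +-cancelʳ-≤ (x * z) (begin
      d + x * z       ≈⟨ +-congʳ (*-identityˡ d) ⟨
      1# * d + x * z  ≤⟨ +-monoˡ-≤ (x * z) (*-monoˡ-≤ 0≤d 1≤x) ⟩
      x * d + x * z   ≈⟨ +-comm _ _ ⟩
      x * z + x * d   ≈⟨ distribˡ x z d ⟨
      x * (z + d)     ≈⟨ *-congˡ y≈z+d ⟨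
      x * y           ≤⟨ xy≤xz ⟩
      x * z           ≈⟨ +-identityˡ _ ⟨
      0# + x * z      ∎)

  square≤1 : ∀ {x} → 0# ≤ x → x ≤ 1# → x * x ≤ 1#
  square≤1 {x} 0≤x x≤1 = begin
    x * x   ≤⟨ *-monoʳ-≤ 0≤x x≤1 ⟩
    x * 1#  ≈⟨ *-identityʳ x ⟩
    x       ≤⟨ x≤1 ⟩
    1#      ∎

  4*≈ : ∀ x → (4 · 1#) * x ≈ (x + x) + (x + x)
  4*≈ x = begin-equality
    -- `4 · 1#` unfolds to `1# + (1# + (1# + (1# + 0#)))`. The solver gets `1#` and `0#` as the
    -- variables `o` and `z`, so the unit and zero laws are applied by hand afterwards.
    (4 · 1#) * x                                 ≈⟨ solve 3 (λ o z x → (o :+ (o :+ (o :+ (o :+ z)))) :* x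
                                                      := ((o :* x :+ o :* x) :+ (o :* x :+ o :* x)) :+ z :* x) refl 1# 0# x ⟩
    (1x + 1x) + (1x + 1x) + 0# * x               ≈⟨ +-cong (+-cong (+-cong e e) (+-cong e e)) (zeroˡ x) ⟩
    (x + x) + (x + x) + 0#                       ≈⟨ +-identityʳ _ ⟩
    (x + x) + (x + x)                            ∎
    where
    1x = 1# * x
    e : 1x ≈ x
    e = *-identityˡ x

  0≤4 : 0# ≤ 4 · 1#
  0≤4 = +-nonneg 0≤1 (+-nonneg 0≤1 (+-nonneg 0≤1 (+-nonneg 0≤1 ≤-refl)))

  4≉0 : ¬ 4 · 1# ≈ 0#
  4≉0 4≈0 = 1≰0 (begin
    1#      ≤⟨ x≤x+y (+-nonneg 0≤1 (+-nonneg 0≤1 (+-nonneg 0≤1 ≤-refl))) ⟩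
    4 · 1#  ≈⟨ 4≈0 ⟩
    0#      ∎)

  0≤¼ : 0# ≤ ¼
  0≤¼ = ⁻¹-nonneg 0≤4 4≉0

  ¼*4* : ∀ x → ¼ * ((4 · 1#) * x) ≈ x
  ¼*4* x = begin-equality
    ¼ * ((4 · 1#) * x)  ≈⟨ *-assoc _ _ _ ⟨
    (¼ * (4 · 1#)) * x  ≈⟨ *-congʳ (trans (*-comm _ _) (*-inverseʳ _ 4≉0)) ⟩
    1# * x              ≈⟨ *-identityˡ x ⟩
    x                   ∎

  4*¼* : ∀ x → (4 · 1#) * (¼ * x) ≈ x
  4*¼* x = trans (solve 3 (λ a b x → a :* (b :* x) := b :* (a :* x)) refl (4 · 1#) ¼ x) (¼*4* x)

  -- The two sides differ by the square of `d`, the difference of `y` and `x`.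
  am-gm : ∀ {x y} → x ≤ y → (4 · 1#) * (x * y) ≤ (x + y) * (x + y)
  am-gm {x} {y} x≤y with ≤⇒difference x≤y
  ... | d , 0≤d , y≈x+d = begin
    (4 · 1#) * (x * y)                               ≈⟨ 4*≈ _ ⟩
    (x * y + x * y) + (x * y + x * y)                ≈⟨ +-cong (+-cong xy xy) (+-cong xy xy) ⟩
    (x * y′ + x * y′) + (x * y′ + x * y′)            ≤⟨ x≤x+y (*-nonneg 0≤d 0≤d) ⟩
    (x * y′ + x * y′) + (x * y′ + x * y′) + d * d    ≈⟨ solve 2 (λ x d → let xy = x :* (x :+ d) in
                                                           ((xy :+ xy) :+ (xy :+ xy)) :+ d :* d
                                                           := (x :+ (x :+ d)) :* (x :+ (x :+ d))) refl x d ⟩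
    (x + y′) * (x + y′)                              ≈⟨ *-cong (+-congˡ y≈x+d) (+-congˡ y≈x+d) ⟨
    (x + y) * (x + y)                                ∎
    where
    y′ = x + d
    xy : x * y ≈ x * y′
    xy = *-congˡ y≈x+d

  -- The source of the constant 1/4 in the upper bound: it will be applied to the rejected share and
  -- its complement.
  product≤¼ : ∀ {x y} → x + y ≈ 1# → x * y ≤ ¼
  product≤¼ {x} {y} x+y≈1 = begin
    x * y                       ≈⟨ ¼*4* _ ⟨
    ¼ * ((4 · 1#) * (x * y))    ≤⟨ *-monoʳ-≤ 0≤¼ 4xy≤ ⟩
    ¼ * ((x + y) * (x + y))     ≈⟨ *-congˡ (*-cong x+y≈1 x+y≈1) ⟩
    ¼ * (1# * 1#)               ≈⟨ *-congˡ (*-identityˡ 1#) ⟩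
    ¼ * 1#                      ≈⟨ *-identityʳ ¼ ⟩
    ¼                           ∎
    where
    4xy≤ : (4 · 1#) * (x * y) ≤ (x + y) * (x + y)
    4xy≤ with total x y
    ... | inj₁ x≤y = am-gm x≤y
    ... | inj₂ y≤x = ≤-trans (≤-reflexive (*-congˡ (*-comm x y)))
                       (≤-trans (am-gm y≤x) (≤-reflexive (*-cong (+-comm y x) (+-comm y x))))

  -- Both cases of drift reduce to q² + 2apq + (ar)² with r ∈ {p, q}, p = 1 − q,
  -- after inserting the units u and v that make the identity homogeneous.
  module _ {a a′ q : Carrier} (0≤a : 0# ≤ a) (a+a′≈1 : a + a′ ≈ 1#) (0≤q : 0# ≤ q) (q≤1 : q ≤ 1#) where

    private
      p u v : Carrier
      p = proj₁ (≤⇒difference q≤1)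
      u = a + a′
      v = p + q

      0≤p : 0# ≤ p
      0≤p = proj₁ (proj₂ (≤⇒difference q≤1))

      v≈1 : v ≈ 1#
      v≈1 = trans (+-comm p q) (sym (proj₂ (proj₂ (≤⇒difference q≤1))))

      p≤1 : p ≤ 1#
      p≤1 = ≤-trans (x≤x+y 0≤q) (≤-reflexive v≈1)

      unit : ∀ {w} → w ≈ 1# → ∀ x → w * x ≈ x
      unit w≈1 x = trans (*-congʳ w≈1) (*-identityˡ x)

      drift-bound : ∀ {r} → 0# ≤ r → r ≤ 1# →
        (u * q) * (u * q) + (a * (u * (p * q)) + a * (u * (p * q))) + (a * a) * (r * r)
          ≤ q * q + (a * ¼ + a * ¼) + a * a
      drift-bound {r} 0≤r r≤1 = +-mono-≤ (+-mono-≤ (≤-reflexive (*-cong uq uq)) (+-mono-≤ apq apq)) arr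
        where
        uq : u * q ≈ q
        uq = unit a+a′≈1 q
        apq : a * (u * (p * q)) ≤ a * ¼
        apq = *-monoʳ-≤ 0≤a (≤-trans (≤-reflexive (unit a+a′≈1 _)) (product≤¼ v≈1))
        arr : (a * a) * (r * r) ≤ a * a
        arr = ≤-trans (*-monoʳ-≤ (*-nonneg 0≤a 0≤a) (square≤1 0≤r r≤1)) (≤-reflexive (*-identityʳ _))

    drift : ∀ b → let q⁺ = a′ * q + (if not b then a else 0#) ; gain = if b then q else 0# in
      q⁺ * q⁺ + (a * gain + a * gain) ≤ q * q + (a * ¼ + a * ¼) + a * a
    drift true = begin
      (a′ * q + 0#) * (a′ * q + 0#) + (a * q + a * q)
        ≈⟨ +-cong (*-cong (+-identityʳ _) (+-identityʳ _)) (+-cong homogenise homogenise) ⟩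
      (a′ * q) * (a′ * q) + (a * (u * (v * q)) + a * (u * (v * q)))
        ≈⟨ solve 4 (λ a a′ p q → let u = a :+ a′ ; v = p :+ q in
             (a′ :* q) :* (a′ :* q) :+ (a :* (u :* (v :* q)) :+ a :* (u :* (v :* q)))
             := ((u :* q) :* (u :* q) :+ (a :* (u :* (p :* q)) :+ a :* (u :* (p :* q)))) :+ (a :* a) :* (q :* q))
             refl a a′ p q ⟩
      (u * q) * (u * q) + (a * (u * (p * q)) + a * (u * (p * q))) + (a * a) * (q * q)
        ≤⟨ drift-bound 0≤q q≤1 ⟩
      q * q + (a * ¼ + a * ¼) + a * a ∎
      where
      homogenise : a * q ≈ a * (u * (v * q))
      homogenise = *-congˡ (sym (trans (unit a+a′≈1 _) (unit v≈1 q)))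
    drift false = begin
      (a′ * q + a) * (a′ * q + a) + (a * 0# + a * 0#)
        ≈⟨ +-cong (*-cong homogenise homogenise) (+-cong (zeroʳ a) (zeroʳ a)) ⟩
      (a′ * q + v * a) * (a′ * q + v * a) + (0# + 0#)
        ≈⟨ trans (+-congˡ (+-identityʳ 0#)) (+-identityʳ _) ⟩
      (a′ * q + v * a) * (a′ * q + v * a)
        ≈⟨ solve 4 (λ a a′ p q → let u = a :+ a′ ; v = p :+ q in
             (a′ :* q :+ v :* a) :* (a′ :* q :+ v :* a)
             := ((u :* q) :* (u :* q) :+ (a :* (u :* (p :* q)) :+ a :* (u :* (p :* q)))) :+ (a :* a) :* (p :* p))
             refl a a′ p q ⟩
      (u * q) * (u * q) + (a * (u * (p * q)) + a * (u * (p * q))) + (a * a) * (p * p)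
        ≤⟨ drift-bound 0≤p p≤1 ⟩
      q * q + (a * ¼ + a * ¼) + a * a ∎
      where
      homogenise : a′ * q + a ≈ a′ * q + v * a
      homogenise = +-congˡ (sym (unit v≈1 a))

-- Cut functions of weighted digraphs.

module CutFunctions {c ℓ₁ ℓ₂} (K : ArchimedeanOrderedField c ℓ₁ ℓ₂) where
  open ArchimedeanOrderedField K hiding (zero)
  open OnlineUSM K
  open OrderedFieldProperties K
  open import Relation.Binary.Reasoning.PartialOrder poset
  open CommutativeMonoidSum +-commutativeMonoid using (∑-distrib-+; sum-cong-≋; sum-init-last; sum-replicate-zero)
  open SemiringSum semiring using (*-distribˡ-sum)

  private
    when : Bool → Carrier → Carrier
    when b x = if b then x else 0#

    when-nonneg : ∀ b {x} → 0# ≤ x → 0# ≤ when b x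
    when-nonneg true  0≤x = 0≤x
    when-nonneg false 0≤x = ≤-refl

  ∑-mono : ∀ {n} {s t : Fin n → Carrier} → (∀ i → s i ≤ t i) → ∑[ i < n ] s i ≤ ∑[ i < n ] t i
  ∑-mono {ℕ.zero}  s≤t = ≤-refl
  ∑-mono {ℕ.suc n} s≤t = +-mono-≤ (s≤t zero) (∑-mono (λ i → s≤t (suc i)))

  ∑-nonneg : ∀ {n} {t : Fin n → Carrier} → (∀ i → 0# ≤ t i) → 0# ≤ ∑[ i < n ] t i
  ∑-nonneg {ℕ.zero}  0≤t = ≤-refl
  ∑-nonneg {ℕ.suc n} 0≤t = +-nonneg (0≤t zero) (∑-nonneg (λ i → 0≤t (suc i)))

  cut-nonNegative : ∀ {n} {w : Fin n → Fin n → Carrier} → (∀ i j → 0# ≤ w i j) → NonNegative (cut w)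
  cut-nonNegative 0≤w S = ∑-nonneg λ i → ∑-nonneg λ j → when-nonneg _ (0≤w i j)

  private
    -- Here `a`, `b` say whether the tail of the arc lies in S, T, and `c`, `d` say the same of its
    -- head. Equality holds except when the arc joins S minus T and T minus S in either direction;
    -- then the left side is zero and the right side is `x`.
    arc-submodular : ∀ a b c d {x} → 0# ≤ x →
      when ((a ∨ b) ∧ not (c ∨ d)) x + when ((a ∧ b) ∧ not (c ∧ d)) x
        ≤ when (a ∧ not c) x + when (b ∧ not d) x
    arc-submodular false false c     d     0≤x = ≤-refl
    arc-submodular true  false true  d     0≤x = ≤-refl
    arc-submodular true  false false true  0≤x = +-monoˡ-≤ 0# 0≤x
    arc-submodular true  false false false 0≤x = ≤-refl
    arc-submodular false true  true  true  0≤x = ≤-refl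
    arc-submodular false true  true  false 0≤x = +-monoʳ-≤ 0# 0≤x
    arc-submodular false true  false true  0≤x = ≤-refl
    arc-submodular false true  false false 0≤x = ≤-reflexive (+-comm _ _)
    arc-submodular true  true  true  true  0≤x = ≤-refl
    arc-submodular true  true  true  false 0≤x = ≤-refl
    arc-submodular true  true  false true  0≤x = ≤-reflexive (+-comm _ _)
    arc-submodular true  true  false false 0≤x = ≤-refl

  cut-submodular : ∀ {n} {w : Fin n → Fin n → Carrier} → (∀ i j → 0# ≤ w i j) → Submodular (cut w)
  cut-submodular {n} {w} 0≤w S T = begin
    cut w (S ∪ T) + cut w (S ∩ T)
      ≈⟨ ∑∑-distrib (arc (S ∪ T)) (arc (S ∩ T)) ⟨
    ∑[ i < n ] ∑[ j < n ] (arc (S ∪ T) i j + arc (S ∩ T) i j)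
      ≤⟨ ∑-mono (λ i → ∑-mono (λ j → submodular i j)) ⟩
    ∑[ i < n ] ∑[ j < n ] (arc S i j + arc T i j)
      ≈⟨ ∑∑-distrib (arc S) (arc T) ⟩
    cut w S + cut w T ∎
    where
    arc : Subset n → Fin n → Fin n → Carrier
    arc U i j = when (lookup U i ∧ not (lookup U j)) (w i j)

    ∑∑-distrib : ∀ (f g : Fin n → Fin n → Carrier) →
      ∑[ i < n ] ∑[ j < n ] (f i j + g i j)
        ≈ ∑[ i < n ] ∑[ j < n ] f i j + ∑[ i < n ] ∑[ j < n ] g i j
    ∑∑-distrib f g = trans (sum-cong-≋ (λ i → ∑-distrib-+ (f i) (g i)))
                           (∑-distrib-+ (λ i → ∑[ j < n ] f i j) (λ i → ∑[ j < n ] g i j))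

    submodular : ∀ i j → arc (S ∪ T) i j + arc (S ∩ T) i j ≤ arc S i j + arc T i j
    submodular i j
      rewrite Vec.lookup-zipWith _∨_ i S T | Vec.lookup-zipWith _∨_ j S T
            | Vec.lookup-zipWith _∧_ i S T | Vec.lookup-zipWith _∧_ j S T
      = arc-submodular (lookup S i) (lookup T i) (lookup S j) (lookup T j) (0≤w i j)

  lookup-∷ʳ-inject₁ : ∀ {n} (T : Subset n) b i → lookup (T ∷ʳ b) (inject₁ i) ≡ lookup T i
  lookup-∷ʳ-inject₁ (x ∷ T) b zero    = ≡.refl
  lookup-∷ʳ-inject₁ (x ∷ T) b (suc i) = lookup-∷ʳ-inject₁ T b i

  lookup-∷ʳ-fromℕ : ∀ {n} (T : Subset n) b → lookup (T ∷ʳ b) (fromℕ n) ≡ b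
  lookup-∷ʳ-fromℕ []      b = ≡.refl
  lookup-∷ʳ-fromℕ (x ∷ T) b = lookup-∷ʳ-fromℕ T b

  -- Solutions grow at the end, so the last term is split off. The summand `φ` sees a position only
  -- as a natural number and a membership bit, which lets one summand serve ground sets of every
  -- size.
  ∑-∷ʳ : ∀ (φ : Bool → ℕ → Carrier) {n} (T : Subset n) b →
    ∑[ i < ℕ.suc n ] φ (lookup (T ∷ʳ b) i) (toℕ i) ≈ ∑[ i < n ] φ (lookup T i) (toℕ i) + φ b n
  ∑-∷ʳ φ {n} T b = trans (sum-init-last {n} (λ i → φ (lookup (T ∷ʳ b) i) (toℕ i)))
    (+-cong
      (sum-cong-≋ (λ i → reflexive (≡.cong₂ φ (lookup-∷ʳ-inject₁ T b i) (Fin.toℕ-inject₁ i))))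
      (reflexive (≡.cong₂ φ (lookup-∷ʳ-fromℕ T b) (Fin.toℕ-fromℕ n))))

  -- What a new vertex adds to the cut when accepted, if it sends an arc of weight `v j` to each
  -- earlier vertex `j`: exactly the arcs into rejected vertices are cut.
  inflow : (ℕ → Carrier) → ∀ {n} → SetFunction n
  inflow v {n} T = ∑[ j < n ] when (not (lookup T j)) (v (toℕ j))

  inflow-nonneg : ∀ {v} → (∀ j → 0# ≤ v j) → ∀ {n} (T : Subset n) → 0# ≤ inflow v T
  inflow-nonneg 0≤v {n} T = ∑-nonneg {n} (λ j → when-nonneg (not (lookup T j)) (0≤v (toℕ j)))

  inflow-∷ʳ : ∀ v {n} (T : Subset n) b → inflow v (T ∷ʳ b) ≈ inflow v T + when (not b) (v n)
  inflow-∷ʳ v = ∑-∷ʳ (λ a j → when (not a) (v j))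

  inflow-cong : ∀ {n} {v v′ : ℕ → Carrier} → (∀ j → j ℕ.< n → v j ≈ v′ j) →
    ∀ (T : Subset n) → inflow v T ≈ inflow v′ T
  inflow-cong {v = v} {v′} v≈v′ T = sum-cong-≋ λ j → lemma (not (lookup T j)) (v≈v′ (toℕ j) (Fin.toℕ<n j))
    where
    lemma : ∀ b {x y} → x ≈ y → when b x ≈ when b y
    lemma true  x≈y = x≈y
    lemma false x≈y = refl

  inflow-* : ∀ x v {n} (T : Subset n) → inflow (λ j → x * v j) T ≈ x * inflow v T
  inflow-* x v {n} T = trans (sum-cong-≋ (λ j → lemma (not (lookup T j))))
    (sym (*-distribˡ-sum x (λ (j : Fin n) → when (not (lookup T j)) (v (toℕ j)))))
    where
    lemma : ∀ b {y} → when b (x * y) ≈ x * when b y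
    lemma true  = refl
    lemma false = sym (zeroʳ x)

  -- Digraphs in which every arc points to an earlier vertex.

  module _ (w : ℕ → ℕ → Carrier) (backward : ∀ {i j} → i ℕ.≤ j → w i j ≈ 0#) where

    backward-cut : ∀ n → SetFunction n
    backward-cut n = cut {n} (λ i j → w (toℕ i) (toℕ j))

    -- No arc enters the new vertex, so its arrival never changes the value of earlier decisions,
    -- and accepting it adds its arcs into rejected vertices.
    backward-cut-∷ʳ : ∀ {n} (T : Subset n) b →
      backward-cut (ℕ.suc n) (T ∷ʳ b) ≈ backward-cut n T + when b (inflow (w n) T)
    backward-cut-∷ʳ {n} T b = trans (∑-∷ʳ (λ a i → row a i (T ∷ʳ b)) T b)
      (+-cong (sum-cong-≋ (λ i → row-∷ʳ (lookup T i) (ℕ.<⇒≤ (Fin.toℕ<n i))))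
              (trans (row-∷ʳ b ℕ.≤-refl) (row-when b n T)))
      where
      -- The bit of the tail and the set that tests the heads are separate arguments, so that the
      -- outer and the inner sum can be split one after the other.
      row : Bool → ℕ → ∀ {m} → Subset m → Carrier
      row a i {m} S = ∑[ j < m ] when (a ∧ not (lookup S j)) (w i (toℕ j))

      when-0 : ∀ a {x} → x ≈ 0# → when a x ≈ 0#
      when-0 true  x≈0 = x≈0
      when-0 false x≈0 = refl

      row-∷ʳ : ∀ a {i} → i ℕ.≤ n → row a i (T ∷ʳ b) ≈ row a i T
      row-∷ʳ a {i} i≤n = trans (∑-∷ʳ (λ b j → when (a ∧ not b) (w i j)) T b)
        (trans (+-congˡ (when-0 (a ∧ not b) (backward i≤n))) (+-identityʳ _))

      row-when : ∀ a i {m} (S : Subset m) → row a i S ≈ when a (inflow (w i) S)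
      row-when true  i     S = refl
      row-when false i {m} S = sum-replicate-zero m

    -- The instances are nested: during the first `n` arrivals an online algorithm cannot tell the
    -- `n`-vertex instance from a longer one.
    backward-cut-restrict : ∀ {n} (T : Subset n) → restrict (backward-cut (ℕ.suc n)) T ≈ backward-cut n T
    backward-cut-restrict T = trans (backward-cut-∷ʳ T false) (+-identityʳ _)

  open MaxOp (maxOperator totalOrder) using (x≤x⊔y; x≤y⊔x)

  ≤max⊆ : ∀ {n} (f : SetFunction n) S → f S ≤ max⊆ f
  ≤max⊆ {ℕ.zero}  f [] = ≤-refl
  ≤max⊆ {ℕ.suc n} f S with initLast S
  ... | T , false , ≡.refl = ≤-trans (≤max⊆ (λ U → f (U ∷ʳ outside)) T) (x≤x⊔y _ _)
  ... | T , true  , ≡.refl = ≤-trans (≤max⊆ (λ U → f (U ∷ʳ inside)) T) (x≤y⊔x _ _)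

-- Sums over subsets and expectations.

module Expectations {c ℓ₁ ℓ₂} (K : ArchimedeanOrderedField c ℓ₁ ℓ₂) where
  open ArchimedeanOrderedField K hiding (zero)
  open OnlineUSM K
  open OrderedFieldProperties K
  open import Relation.Binary.Reasoning.PartialOrder poset
  open NaturalCoefficients commutativeSemiring using (solve; _:=_; _:+_; _:*_)

  ∑⊆-mono : ∀ {n} {g h : SetFunction n} → (∀ T → g T ≤ h T) → ∑⊆ g ≤ ∑⊆ h
  ∑⊆-mono {ℕ.zero}  g≤h = g≤h []
  ∑⊆-mono {ℕ.suc n} g≤h = +-mono-≤ (∑⊆-mono (λ T → g≤h (T ∷ʳ outside))) (∑⊆-mono (λ T → g≤h (T ∷ʳ inside)))

  ∑⊆-cong : ∀ {n} {g h : SetFunction n} → (∀ T → g T ≈ h T) → ∑⊆ g ≈ ∑⊆ h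
  ∑⊆-cong g≈h = ≤-antisym (∑⊆-mono (λ T → ≤-reflexive (g≈h T)))
                          (∑⊆-mono (λ T → ≤-reflexive (sym (g≈h T))))

  ∑⊆-+ : ∀ {n} (g h : SetFunction n) → ∑⊆ (λ T → g T + h T) ≈ ∑⊆ g + ∑⊆ h
  ∑⊆-+ {ℕ.zero}  g h = refl
  ∑⊆-+ {ℕ.suc n} g h = trans (+-cong (∑⊆-+ {n} _ _) (∑⊆-+ {n} _ _))
    (solve 4 (λ a b c d → (a :+ b) :+ (c :+ d) := (a :+ c) :+ (b :+ d)) refl _ _ _ _)

  ∑⊆-* : ∀ {n} x (h : SetFunction n) → ∑⊆ (λ T → x * h T) ≈ x * ∑⊆ h
  ∑⊆-* {ℕ.zero}  x h = refl
  ∑⊆-* {ℕ.suc n} x h = trans (+-cong (∑⊆-* {n} x _) (∑⊆-* {n} x _)) (sym (distribˡ x _ _))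

  ∑⊆-nonneg : ∀ {n} {h : SetFunction n} → (∀ T → 0# ≤ h T) → 0# ≤ ∑⊆ h
  ∑⊆-nonneg {ℕ.zero}  0≤h = 0≤h []
  ∑⊆-nonneg {ℕ.suc n} 0≤h = +-nonneg (∑⊆-nonneg (λ T → 0≤h (T ∷ʳ outside))) (∑⊆-nonneg (λ T → 0≤h (T ∷ʳ inside)))

  ∈-inject₁⁺ : ∀ {n} {T : Subset n} {b i} → i ∈ T → inject₁ i ∈ T ∷ʳ b
  ∈-inject₁⁺ here        = here
  ∈-inject₁⁺ (there i∈T) = there (∈-inject₁⁺ i∈T)

  ∈-inject₁⁻ : ∀ {n} {T : Subset n} {b} i → inject₁ i ∈ T ∷ʳ b → i ∈ T
  ∈-inject₁⁻ {T = x ∷ T} zero    here        = here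
  ∈-inject₁⁻ {T = x ∷ T} (suc i) (there i∈T) = there (∈-inject₁⁻ i i∈T)

  ∷ʳ-cancel-⊆ : ∀ {n} {S T : Subset n} {b c} → S ∷ʳ b ⊆ T ∷ʳ c → S ⊆ T
  ∷ʳ-cancel-⊆ S⊆T {i} i∈S = ∈-inject₁⁻ i (S⊆T (∈-inject₁⁺ i∈S))

  _≟_ : ∀ {n} (S T : Subset n) → Dec (S ≡ T)
  _≟_ = Vec.≡-dec Bool._≟_

  -- The random solution along a nested sequence of instances.

  module AlgorithmRun {o e} {Ω : ProbabilitySpace o e}
    (A : OnlineAlgorithm Ω) (noPreemption : NoPreemption A)
    (f : ∀ n → SetFunction n) (f-restrict : ∀ {n} (T : Subset n) → restrict (f (ℕ.suc n)) T ≈ f n T) where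

    open ProbabilitySpace Ω
    open OnlineAlgorithm A

    law : ∀ {n} → Subset n → Carrier
    law {n} T = Pr (λ ω → ω ends-with T on f n)

    -- A finite sum against the law of the solution. For the objective itself, `𝔼 (f n)` unfolds to
    -- `expectedValue (f n)`.
    𝔼 : ∀ {n} → SetFunction n → Carrier
    𝔼 h = ∑⊆ (λ T → law T * h T)

    law-nonneg : ∀ {n} (T : Subset n) → 0# ≤ law T
    law-nonneg {n} T = Pr-nonneg (measurable (f n) T)

    𝔼-nonneg : ∀ {n} {h : SetFunction n} → (∀ T → 0# ≤ h T) → 0# ≤ 𝔼 h
    𝔼-nonneg 0≤h = ∑⊆-nonneg (λ T → *-nonneg (law-nonneg T) (0≤h T))

    𝔼-mono : ∀ {n} {g h : SetFunction n} → (∀ T → g T ≤ h T) → 𝔼 g ≤ 𝔼 h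
    𝔼-mono g≤h = ∑⊆-mono (λ T → *-monoʳ-≤ (law-nonneg T) (g≤h T))

    𝔼-+ : ∀ {n} (g h : SetFunction n) → 𝔼 (λ T → g T + h T) ≈ 𝔼 g + 𝔼 h
    𝔼-+ g h = trans (∑⊆-cong (λ T → distribˡ (law T) (g T) (h T))) (∑⊆-+ (λ T → law T * g T) (λ T → law T * h T))

    𝔼-* : ∀ {n} x (h : SetFunction n) → 𝔼 (λ T → x * h T) ≈ x * 𝔼 h
    𝔼-* x h = trans (∑⊆-cong (λ T → solve 3 (λ a b c → a :* (b :* c) := b :* (a :* c)) refl (law T) x (h T)))
                    (∑⊆-* x (λ T → law T * h T))

    -- Feasibility bounds the new solution from above and the absence of preemption bounds it from
    -- below. The bounds agree on all old positions, and `cong` replaces the restricted oracle by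
    -- `f n`.
    solution-∷ʳ : ∀ ω n → ∃[ b ] solution ω (ℕ.suc n) (f (ℕ.suc n)) ≡ solution ω n (f n) ∷ʳ b
    solution-∷ʳ ω n with initLast (solution ω (ℕ.suc n) (f (ℕ.suc n)))
                       | feasible ω n (f (ℕ.suc n)) | noPreemption ω n (f (ℕ.suc n))
    ... | T , b , S≡T∷ʳb | upper | lower rewrite S≡T∷ʳb =
      b , ≡.cong (_∷ʳ b) (≡.trans (⊆-antisym (∷ʳ-cancel-⊆ upper) (∷ʳ-cancel-⊆ lower))
                                  (cong ω n f-restrict))

    -- By `solution-∷ʳ`, holding `T` now is the disjoint union of holding one of its two extensions
    -- after the next arrival.
    law-∷ʳ : ∀ {n} (T : Subset n) → law (T ∷ʳ outside) + law (T ∷ʳ inside) ≈ law T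
    law-∷ʳ {n} T = begin-equality
      law (T ∷ʳ outside) + law (T ∷ʳ inside)  ≈⟨ Pr-∨ (m outside) (m inside) disjoint ⟨
      Pr _                                    ≈⟨ Pr-cong (Event-∨ (m outside) (m inside)) union ⟩
      law T                                   ∎
      where
      m : ∀ b → Event (λ ω → ω ends-with (T ∷ʳ b) on f (ℕ.suc n))
      m b = measurable (f (ℕ.suc n)) (T ∷ʳ b)

      disjoint : ∀ ω → (ω ends-with (T ∷ʳ outside) on f (ℕ.suc n)) ∧ (ω ends-with (T ∷ʳ inside) on f (ℕ.suc n)) ≡ false
      disjoint ω = dec-false (solution ω _ (f _) ≟ (T ∷ʳ outside) ×-dec solution ω _ (f _) ≟ (T ∷ʳ inside))
        λ (S≡out , S≡in) → contradiction (Vec.∷ʳ-injectiveʳ T T (≡.trans (≡.sym S≡out) S≡in)) λ ()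

      union : ∀ ω → (ω ends-with (T ∷ʳ outside) on f (ℕ.suc n)) ∨ (ω ends-with (T ∷ʳ inside) on f (ℕ.suc n))
                      ≡ ω ends-with T on f n
      union ω with solution-∷ʳ ω n
      -- The Boolean disjunction is the `does` of the decided sum type, so a logical equivalence is
      -- enough.
      ... | b , S′≡S∷ʳb = does-⇔ (mk⇔ to (from b S′≡S∷ʳb)) (_ ≟ (T ∷ʳ outside) ⊎-dec _ ≟ (T ∷ʳ inside)) (_ ≟ T)
        where
        S′ = solution ω (ℕ.suc n) (f (ℕ.suc n))
        S  = solution ω n (f n)
        to : S′ ≡ T ∷ʳ outside ⊎ S′ ≡ T ∷ʳ inside → S ≡ T
        to (inj₁ eq) = Vec.∷ʳ-injectiveˡ S T (≡.trans (≡.sym S′≡S∷ʳb) eq)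
        to (inj₂ eq) = Vec.∷ʳ-injectiveˡ S T (≡.trans (≡.sym S′≡S∷ʳb) eq)
        from : ∀ b → S′ ≡ S ∷ʳ b → S ≡ T → S′ ≡ T ∷ʳ outside ⊎ S′ ≡ T ∷ʳ inside
        from false eq S≡T = inj₁ (≡.trans eq (≡.cong (_∷ʳ outside) S≡T))
        from true  eq S≡T = inj₂ (≡.trans eq (≡.cong (_∷ʳ inside) S≡T))

    -- A bound valid for both decisions passes to expectations whatever their probabilities, because
    -- the masses of the two extensions add up to `law T`. This replaces conditional expectation.
    𝔼-step : ∀ {n} (h : SetFunction (ℕ.suc n)) (g : SetFunction n) →
      (∀ T b → h (T ∷ʳ b) ≤ g T) → 𝔼 h ≤ 𝔼 g
    𝔼-step {n} h g h≤g = begin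
      𝔼 h
        ≈⟨ ∑⊆-+ (λ T → law (T ∷ʳ outside) * h (T ∷ʳ outside)) (λ T → law (T ∷ʳ inside) * h (T ∷ʳ inside)) ⟨
      ∑⊆ (λ T → law (T ∷ʳ outside) * h (T ∷ʳ outside) + law (T ∷ʳ inside) * h (T ∷ʳ inside))
        ≤⟨ ∑⊆-mono (λ T → +-mono-≤ (*-monoʳ-≤ (law-nonneg (T ∷ʳ outside)) (h≤g T outside))
                                   (*-monoʳ-≤ (law-nonneg (T ∷ʳ inside)) (h≤g T inside))) ⟩
      ∑⊆ (λ T → law (T ∷ʳ outside) * g T + law (T ∷ʳ inside) * g T)
        ≈⟨ ∑⊆-cong (λ T → trans (sym (distribʳ (g T) _ _)) (*-congʳ (law-∷ʳ T))) ⟩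
      𝔼 g ∎

    -- The law has total mass one: this is clear for the empty ground set, and `𝔼-step` carries it
    -- through each arrival.
    𝔼-const : ∀ n x → 𝔼 {n} (λ _ → x) ≤ x
    𝔼-const ℕ.zero x = begin
      law [] * x  ≈⟨ *-congʳ (trans (Pr-cong (measurable (f 0) []) certain) Pr-all) ⟩
      1# * x      ≈⟨ *-identityˡ x ⟩
      x           ∎
      where
      certain : ∀ ω → ω ends-with [] on f 0 ≡ true
      certain ω = dec-true (solution ω 0 (f 0) ≟ []) (empty (solution ω 0 (f 0)))
        where
        empty : ∀ (S : Subset 0) → S ≡ []
        empty [] = ≡.refl
    𝔼-const (ℕ.suc n) x = ≤-trans (𝔼-step {n} (λ _ → x) (λ _ → x) (λ _ _ → ≤-refl)) (𝔼-const n x)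

-- The hard instance with rate η.

module HardInstance {c ℓ₁ ℓ₂} (K : ArchimedeanOrderedField c ℓ₁ ℓ₂) where
  open ArchimedeanOrderedField K hiding (zero)
  open OnlineUSM K
  open CutFunctions K
  open Expectations K
  open OrderedFieldProperties K
  open SemiringExp semiring using (_^_)
  open import Relation.Binary.Reasoning.PartialOrder poset
  open NaturalCoefficients commutativeSemiring using (solve; _:=_; _:+_; _:*_)

  module _ {η : Carrier} (0≤η : 0# ≤ η) (η≉0 : ¬ η ≈ 0#) (η≤1 : η ≤ 1#) where

    η′ : Carrier
    η′ = 1# + - η

    η+η′≈1 : η + η′ ≈ 1#
    η+η′≈1 = begin-equality
      η + (1# + - η)  ≈⟨ +-comm _ _ ⟩
      (1# + - η) + η  ≈⟨ +-assoc _ _ _ ⟩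
      1# + (- η + η)  ≈⟨ +-congˡ (-‿inverseˡ η) ⟩
      1# + 0#         ≈⟨ +-identityʳ 1# ⟩
      1#              ∎

    0≤η′ : 0# ≤ η′
    0≤η′ = ≤-trans (≤-reflexive (sym (-‿inverseʳ η))) (+-monoˡ-≤ (- η) η≤1)

    -- Chosen so that `η * M ≈ η + 1#`, which is what closes the induction in `f-past≤`.
    M : Carrier
    M = 1# + η ⁻¹

    1≤M : 1# ≤ M
    1≤M = x≤x+y (⁻¹-nonneg 0≤η η≉0)

    η*M≈η+1 : η * M ≈ η + 1#
    η*M≈η+1 = trans (distribˡ η 1# (η ⁻¹)) (+-cong (*-identityʳ η) (*-inverseʳ η η≉0))

    1≤M^ : ∀ k → 1# ≤ M ^ k
    1≤M^ ℕ.zero    = ≤-refl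
    1≤M^ (ℕ.suc k) = begin
      1#         ≤⟨ 1≤M ⟩
      M          ≈⟨ *-identityʳ M ⟨
      M * 1#     ≤⟨ *-monoʳ-≤ (≤-trans 0≤1 1≤M) (1≤M^ k) ⟩
      M * M ^ k  ∎

    0≤M^ : ∀ k → 0# ≤ M ^ k
    0≤M^ k = ≤-trans 0≤1 (1≤M^ k)

    -- `share k` distributes mass one over the vertices 0 to k: each new vertex receives η and the
    -- older masses shrink by `η′`. Vertex 0 starts with mass one instead of η, so the total is one
    -- from the start.
    share : ℕ → ℕ → Carrier
    share ℕ.zero    ℕ.zero    = 1#
    share ℕ.zero    (ℕ.suc j) = 0#
    share (ℕ.suc k) j         = if does (j ℕ.≟ ℕ.suc k) then η else η′ * share k j

    share-≤ : ∀ {k j} → j ℕ.≤ k → share (ℕ.suc k) j ≡ η′ * share k j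
    share-≤ {k} {j} j≤k rewrite dec-false (j ℕ.≟ ℕ.suc k) (λ { ≡.refl → ℕ.1+n≰n j≤k }) = ≡.refl

    share-new : ∀ k → share (ℕ.suc k) (ℕ.suc k) ≡ η
    share-new k rewrite dec-true (k ℕ.≟ k) ≡.refl = ≡.refl

    share-> : ∀ {k j} → k ℕ.< j → share k j ≈ 0#
    share-> {ℕ.zero}  {ℕ.suc j} k<j = refl
    share-> {ℕ.suc k} {j}       k<j
      rewrite dec-false (j ℕ.≟ ℕ.suc k) (λ { ≡.refl → ℕ.1+n≰n k<j })
      = trans (*-congˡ (share-> (ℕ.<-trans (ℕ.n<1+n k) k<j))) (zeroʳ η′)

    0≤share : ∀ k j → 0# ≤ share k j
    0≤share ℕ.zero    ℕ.zero    = 0≤1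
    0≤share ℕ.zero    (ℕ.suc j) = ≤-refl
    0≤share (ℕ.suc k) j with does (j ℕ.≟ ℕ.suc k)
    ... | true  = 0≤η
    ... | false = *-nonneg 0≤η′ (0≤share k j)

    weight : ℕ → ℕ → Carrier
    weight ℕ.zero    j = 0#
    weight (ℕ.suc k) j = M ^ k * share k j

    0≤weight : ∀ i j → 0# ≤ weight i j
    0≤weight ℕ.zero    j = ≤-refl
    0≤weight (ℕ.suc k) j = *-nonneg (0≤M^ k) (0≤share k j)

    weight-backward : ∀ {i j} → i ℕ.≤ j → weight i j ≈ 0#
    weight-backward {ℕ.zero}  i≤j = refl
    weight-backward {ℕ.suc k} i≤j = trans (*-congˡ (share-> i≤j)) (zeroʳ _)

    f : ∀ n → SetFunction n
    f = backward-cut weight weight-backward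

    f-valid : ∀ n → NonNegative (f n) × Submodular (f n) × IsDirectedCut (f n)
    f-valid n = cut-nonNegative {n} 0≤w , cut-submodular {n} 0≤w , (_ , 0≤w , λ _ → refl)
      where
      0≤w : ∀ (i j : Fin n) → 0# ≤ weight (toℕ i) (toℕ j)
      0≤w i j = 0≤weight (toℕ i) (toℕ j)

    -- The quantity Q of the overview, after `k + 1` arrivals.
    rejected : ∀ {k} → SetFunction (ℕ.suc k)
    rejected {k} = inflow (share k)

    rejected-∷ʳ : ∀ {k} (T : Subset (ℕ.suc k)) b →
      rejected (T ∷ʳ b) ≈ η′ * rejected T + (if not b then η else 0#)
    rejected-∷ʳ {k} T b = trans (inflow-∷ʳ (share (ℕ.suc k)) T b)
      (+-cong (trans (inflow-cong (λ j j<1+k → reflexive (share-≤ (ℕ.≤-pred j<1+k))) T)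
                     (inflow-* η′ (share k) T))
              (reflexive (≡.cong (if not b then_else 0#) (share-new k))))

    0≤rejected : ∀ {k} (T : Subset (ℕ.suc k)) → 0# ≤ rejected T
    0≤rejected {k} T = inflow-nonneg (0≤share k) T

    rejected≤1 : ∀ {k} (T : Subset (ℕ.suc k)) → rejected T ≤ 1#
    rejected≤1 {ℕ.zero}  (true ∷ [])  = ≤-trans (≤-reflexive (+-identityʳ _)) 0≤1
    rejected≤1 {ℕ.zero}  (false ∷ []) = ≤-reflexive (+-identityʳ _)
    rejected≤1 {ℕ.suc k} S with initLast S
    ... | T , b , ≡.refl = begin
      rejected (T ∷ʳ b)                                ≈⟨ rejected-∷ʳ T b ⟩
      η′ * rejected T + (if not b then η else 0#)      ≤⟨ +-mono-≤ (*-monoʳ-≤ 0≤η′ (rejected≤1 T)) (≤η (not b)) ⟩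
      η′ * 1# + η                                      ≈⟨ +-congʳ (*-identityʳ η′) ⟩
      η′ + η                                           ≈⟨ +-comm η′ η ⟩
      η + η′                                           ≈⟨ η+η′≈1 ⟩
      1#                                               ∎
      where
      ≤η : ∀ b → (if b then η else 0#) ≤ η
      ≤η true  = ≤-refl
      ≤η false = 0≤η

    -- The product X Q of the overview, with `b` deciding the vertex that arrives after `T`.
    gain : Bool → ∀ {k} → SetFunction (ℕ.suc k)
    gain b T = if b then rejected T else 0#

    f-∷ʳ : ∀ {k} (T : Subset (ℕ.suc k)) b →
      f (ℕ.suc (ℕ.suc k)) (T ∷ʳ b) ≈ f (ℕ.suc k) T + M ^ k * gain b T
    f-∷ʳ {k} T b = trans (backward-cut-∷ʳ weight weight-backward T b) (+-congˡ (lemma b))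
      where
      lemma : ∀ b → (if b then inflow (weight (ℕ.suc k)) T else 0#) ≈ M ^ k * gain b T
      lemma true  = inflow-* (M ^ k) (share k) T
      lemma false = sym (zeroʳ _)

    -- The first vertex has no outgoing arcs, and each later step adds at most `M ^ k`, where
    -- `η * M ^ k + M ^ k ≈ η * M ^ (k + 1)`. With `k + 1` vertices present, the arcs of total
    -- weight `M ^ k` are still to come.
    f-past≤ : ∀ {k} (T : Subset (ℕ.suc k)) → f (ℕ.suc k) T ≤ η * M ^ k
    f-past≤ {ℕ.zero} (b ∷ []) = begin
      f 1 (b ∷ [])  ≈⟨ trans (+-identityʳ _) (trans (+-identityʳ _) (0-if (b ∧ not b))) ⟩
      0#            ≤⟨ *-nonneg 0≤η 0≤1 ⟩
      η * 1#        ∎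
      where
      0-if : ∀ b → (if b then 0# else 0#) ≈ 0#
      0-if true  = refl
      0-if false = refl
    f-past≤ {ℕ.suc k} S with initLast S
    ... | T , b , ≡.refl = begin
      f (ℕ.suc (ℕ.suc k)) (T ∷ʳ b)                               ≈⟨ f-∷ʳ T b ⟩
      f (ℕ.suc k) T + M ^ k * gain b T     ≤⟨ +-mono-≤ (f-past≤ T) (gain≤ b) ⟩
      η * M ^ k + M ^ k                                          ≈⟨ +-congˡ (*-identityˡ _) ⟨
      η * M ^ k + 1# * M ^ k                                     ≈⟨ distribʳ (M ^ k) η 1# ⟨
      (η + 1#) * M ^ k                                           ≈⟨ *-congʳ η*M≈η+1 ⟨
      (η * M) * M ^ k                                            ≈⟨ *-assoc η M _ ⟩
      η * (M * M ^ k)                                            ∎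
      where
      gain≤ : ∀ b → M ^ k * gain b T ≤ M ^ k
      gain≤ true  = ≤-trans (*-monoʳ-≤ (0≤M^ k) (rejected≤1 T)) (≤-reflexive (*-identityʳ _))
      gain≤ false = ≤-trans (≤-reflexive (zeroʳ _)) (0≤M^ k)

    -- Accepting only the last vertex cuts all of its arcs.
    optimum≥ : ∀ k → M ^ k ≤ max⊆ (f (ℕ.suc (ℕ.suc k)))
    optimum≥ k = begin
      M ^ k                                      ≈⟨ *-identityʳ _ ⟨
      M ^ k * 1#                                 ≈⟨ *-congˡ (rejected-none k) ⟨
      M ^ k * rejected (none k)                  ≤⟨ x≤x+y (cut-nonNegative {ℕ.suc k} (λ i j → 0≤weight (toℕ i) (toℕ j)) (none k)) ⟩
      M ^ k * rejected (none k) + f _ (none k)   ≈⟨ +-comm _ _ ⟩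
      f _ (none k) + M ^ k * rejected (none k)   ≈⟨ f-∷ʳ (none k) inside ⟨
      f _ (none k ∷ʳ inside)                     ≤⟨ ≤max⊆ (f (ℕ.suc (ℕ.suc k))) (none k ∷ʳ inside) ⟩
      max⊆ (f (ℕ.suc (ℕ.suc k)))                 ∎
      where
      -- Built by appending at the end, so that `rejected-∷ʳ` applies directly.
      none : ∀ k → Subset (ℕ.suc k)
      none ℕ.zero    = [] ∷ʳ outside
      none (ℕ.suc k) = none k ∷ʳ outside

      rejected-none : ∀ k → rejected (none k) ≈ 1#
      rejected-none ℕ.zero    = +-identityʳ 1#
      rejected-none (ℕ.suc k) = begin-equality
        rejected (none k ∷ʳ outside)   ≈⟨ rejected-∷ʳ (none k) outside ⟩
        η′ * rejected (none k) + η     ≈⟨ +-congʳ (trans (*-congˡ (rejected-none k)) (*-identityʳ η′)) ⟩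
        η′ + η                         ≈⟨ trans (+-comm η′ η) η+η′≈1 ⟩
        1#                             ∎

    -- The quadratic potential and its drift.

    potential : ∀ {k} → SetFunction (ℕ.suc k)
    potential T = rejected T * rejected T

    potential-drift : ∀ {k} (T : Subset (ℕ.suc k)) b →
      potential (T ∷ʳ b) + (η * gain b T + η * gain b T) ≤ potential T + (η * ¼ + η * ¼) + η * η
    potential-drift T b = ≤-trans
      (≤-reflexive (+-congʳ (*-cong (rejected-∷ʳ T b) (rejected-∷ʳ T b))))
      (drift 0≤η η+η′≈1 (0≤rejected T) (rejected≤1 T) b)

    0≤potential : ∀ {k} (T : Subset (ℕ.suc k)) → 0# ≤ potential T
    0≤potential T = *-nonneg (0≤rejected T) (0≤rejected T)

    potential≤1 : ∀ {k} (T : Subset (ℕ.suc k)) → potential T ≤ 1#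
    potential≤1 T = square≤1 (0≤rejected T) (rejected≤1 T)

    -- Contradiction from a competitive algorithm.

    module _ {o e} {Ω : ProbabilitySpace o e} (A : OnlineAlgorithm Ω) (noPreemption : NoPreemption A)
      {ε : Carrier} (2η≤ε : η + η ≤ ε)
      (competitive : Competitive A (¼ + ε) (λ g → NonNegative g × Submodular g × IsDirectedCut g)) where

      open AlgorithmRun A noPreemption f (λ {n} → backward-cut-restrict weight weight-backward {n})

      𝔼-potential : ℕ → Carrier
      𝔼-potential k = 𝔼 {ℕ.suc k} potential

      𝔼-f≥ : ∀ k → (¼ + (η + η)) * M ^ k ≤ 𝔼 (f (ℕ.suc (ℕ.suc k)))
      𝔼-f≥ k = begin
        (¼ + (η + η)) * M ^ k                          ≤⟨ *-monoˡ-≤ (0≤M^ k) (+-monoʳ-≤ ¼ 2η≤ε) ⟩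
        (¼ + ε) * M ^ k                                ≤⟨ *-monoʳ-≤ 0≤¼+ε (optimum≥ k) ⟩
        (¼ + ε) * max⊆ (f (ℕ.suc (ℕ.suc k)))           ≤⟨ competitive _ _ (f-valid (ℕ.suc (ℕ.suc k))) ⟩
        𝔼 (f (ℕ.suc (ℕ.suc k)))                        ∎
        where
        0≤¼+ε : 0# ≤ ¼ + ε
        0≤¼+ε = +-nonneg 0≤¼ (≤-trans (+-nonneg 0≤η 0≤η) 2η≤ε)

      -- Potential and objective are combined into the single function `V * potential + 2 η f⁺`, to
      -- which `𝔼-step` applies. Scaling by `V` keeps division out until the final cancellation. Of
      -- the slack 2η in the ratio, one η pays for the earlier arcs; the other contributes 2η², of
      -- which the second-order drift term consumes η².
      𝔼-potential-decrease : ∀ k → 𝔼-potential (ℕ.suc k) + η * η ≤ 𝔼-potential k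
      𝔼-potential-decrease k = +-cancelʳ-≤ D (*-cancelˡ-≤ (1≤M^ k) (begin
        V * ((Φ⁺ + η * η) + D)
          ≈⟨ solve 4 (λ V η h Φ → let D = (η :* h :+ η :* h) :+ ((η :* η :+ η :* η) :+ η :* η)
                                      F = (h :+ (η :+ η)) :* V in
               V :* ((Φ :+ η :* η) :+ D) := V :* Φ :+ (η :* F :+ η :* F)) refl V η ¼ Φ⁺ ⟩
        V * Φ⁺ + (η * ((¼ + (η + η)) * V) + η * ((¼ + (η + η)) * V))
          ≤⟨ +-monoʳ-≤ (V * Φ⁺) (+-mono-≤ (*-monoʳ-≤ 0≤η (𝔼-f≥ k)) (*-monoʳ-≤ 0≤η (𝔼-f≥ k))) ⟩
        V * Φ⁺ + (η * 𝔼 f⁺ + η * 𝔼 f⁺)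
          ≈⟨ +-cong (𝔼-* V (potential {ℕ.suc k}))
               (trans (𝔼-+ (λ S → η * f⁺ S) (λ S → η * f⁺ S)) (+-cong (𝔼-* η f⁺) (𝔼-* η f⁺))) ⟨
        𝔼 (λ S → V * potential {ℕ.suc k} S) + 𝔼 (λ S → η * f⁺ S + η * f⁺ S)
          ≈⟨ 𝔼-+ (λ S → V * potential {ℕ.suc k} S) (λ S → η * f⁺ S + η * f⁺ S) ⟨
        𝔼 (λ S → V * potential {ℕ.suc k} S + (η * f⁺ S + η * f⁺ S))
          ≤⟨ 𝔼-step (λ S → V * potential {ℕ.suc k} S + (η * f⁺ S + η * f⁺ S))
                    (λ T → V * potential {k} T + V * D) pointwise ⟩
        𝔼 (λ T → V * potential {k} T + V * D)
          ≈⟨ trans (𝔼-+ (λ T → V * potential {k} T) (λ _ → V * D)) (+-congʳ (𝔼-* V (potential {k}))) ⟩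
        V * Φ + 𝔼 {ℕ.suc k} (λ _ → V * D)
          ≤⟨ +-monoʳ-≤ (V * Φ) (𝔼-const (ℕ.suc k) (V * D)) ⟩
        V * Φ + V * D
          ≈⟨ distribˡ V Φ D ⟨
        V * (Φ + D) ∎))
        where
        V  = M ^ k
        -- One η² is the second-order term of the drift, and the other two come from applying
        -- `f-past≤` to both copies of `η * F`. Adding the claimed drop η² gives 4η², which matches
        -- 2η times the slack 2η.
        D  = (η * ¼ + η * ¼) + ((η * η + η * η) + η * η)
        Φ  = 𝔼-potential k
        Φ⁺ = 𝔼-potential (ℕ.suc k)
        f⁺ = f (ℕ.suc (ℕ.suc k))

        pointwise : ∀ T b →
          V * potential (T ∷ʳ b) + (η * f⁺ (T ∷ʳ b) + η * f⁺ (T ∷ʳ b)) ≤ V * potential T + V * D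
        pointwise T b = begin
          V * potential (T ∷ʳ b) + (η * f⁺ (T ∷ʳ b) + η * f⁺ (T ∷ʳ b))
            ≈⟨ +-congˡ (+-cong (*-congˡ (f-∷ʳ T b)) (*-congˡ (f-∷ʳ T b))) ⟩
          V * potential (T ∷ʳ b) + (η * (F + V * gain b T) + η * (F + V * gain b T))
            ≈⟨ solve 5 (λ V Φ η F g → V :* Φ :+ (η :* (F :+ V :* g) :+ η :* (F :+ V :* g))
                 := V :* (Φ :+ (η :* g :+ η :* g)) :+ (η :* F :+ η :* F)) refl V (potential (T ∷ʳ b)) η F (gain b T) ⟩
          V * (potential (T ∷ʳ b) + (η * gain b T + η * gain b T)) + (η * F + η * F)
            ≤⟨ +-mono-≤ (*-monoʳ-≤ (0≤M^ k) (potential-drift T b)) (+-mono-≤ ηF≤ ηF≤) ⟩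
          V * (potential T + (η * ¼ + η * ¼) + η * η) + (η * (η * V) + η * (η * V))
            ≈⟨ solve 4 (λ V Φ η h → V :* ((Φ :+ (η :* h :+ η :* h)) :+ η :* η) :+ (η :* (η :* V) :+ η :* (η :* V))
                 := V :* Φ :+ V :* ((η :* h :+ η :* h) :+ ((η :* η :+ η :* η) :+ η :* η))) refl V (potential T) η ¼ ⟩
          V * potential T + V * D ∎
          where
          F = f (ℕ.suc k) T
          ηF≤ : η * F ≤ η * (η * V)
          ηF≤ = *-monoʳ-≤ 0≤η (f-past≤ T)

      𝔼-potential-bound : ∀ k → 𝔼-potential k + (k · 1#) * (η * η) ≤ 1#
      𝔼-potential-bound ℕ.zero = begin
        𝔼-potential 0 + 0# * (η * η)  ≈⟨ trans (+-congˡ (zeroˡ _)) (+-identityʳ _) ⟩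
        𝔼-potential 0                 ≤⟨ 𝔼-mono (potential≤1 {0}) ⟩
        𝔼 {1} (λ _ → 1#)              ≤⟨ 𝔼-const 1 1# ⟩
        1#                            ∎
      𝔼-potential-bound (ℕ.suc k) = begin
        𝔼-potential (ℕ.suc k) + (1# + k · 1#) * (η * η)
          ≈⟨ +-congˡ (trans (distribʳ _ _ _) (+-congʳ (*-identityˡ _))) ⟩
        𝔼-potential (ℕ.suc k) + (η * η + (k · 1#) * (η * η))
          ≈⟨ +-assoc _ _ _ ⟨
        (𝔼-potential (ℕ.suc k) + η * η) + (k · 1#) * (η * η)
          ≤⟨ +-monoˡ-≤ _ (𝔼-potential-decrease k) ⟩
        𝔼-potential k + (k · 1#) * (η * η)
          ≤⟨ 𝔼-potential-bound k ⟩
        1# ∎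

      k·η²≤1 : ∀ k → (k · 1#) * (η * η) ≤ 1#
      k·η²≤1 k = begin
        (k · 1#) * (η * η)                   ≤⟨ x≤x+y (𝔼-nonneg (0≤potential {k})) ⟩
        (k · 1#) * (η * η) + 𝔼-potential k   ≈⟨ +-comm _ _ ⟩
        𝔼-potential k + (k · 1#) * (η * η)   ≤⟨ 𝔼-potential-bound k ⟩
        1#                                   ∎

      contradictory : ⊥
      -- The summand `1#` supplies strictness: multiplying by η² gives η² + 1 ≤ k η² ≤ 1, so η²
      -- vanishes, and hence η does.
      contradictory with archimedean (1# + η ⁻¹ * η ⁻¹)
      ... | k , 1+η⁻²≤k = η≉0 (begin-equality
        η                ≈⟨ *-identityʳ η ⟨
        η * 1#           ≈⟨ *-congˡ (*-inverseʳ η η≉0) ⟨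
        η * (η * η ⁻¹)   ≈⟨ *-assoc _ _ _ ⟨
        (η * η) * η ⁻¹   ≈⟨ *-congʳ η²≈0 ⟩
        0# * η ⁻¹        ≈⟨ zeroˡ _ ⟩
        0#               ∎)
        where
        square-* : ∀ x y → (x * y) * (x * y) ≈ (y * y) * (x * x)
        square-* = solve 2 (λ x y → (x :* y) :* (x :* y) := (y :* y) :* (x :* x)) refl

        η²≈0 : η * η ≈ 0#
        η²≈0 = ≤-antisym (+-cancelʳ-≤ 1# (begin
          η * η + 1#                          ≈⟨ +-congˡ (*-identityʳ 1#) ⟨
          η * η + 1# * 1#                     ≈⟨ +-congˡ (*-cong (*-inverseʳ η η≉0) (*-inverseʳ η η≉0)) ⟨
          η * η + (η * η ⁻¹) * (η * η ⁻¹)     ≈⟨ +-cong (sym (*-identityˡ _)) (square-* η (η ⁻¹)) ⟩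
          1# * (η * η) + (η ⁻¹ * η ⁻¹) * (η * η)  ≈⟨ distribʳ _ _ _ ⟨
          (1# + η ⁻¹ * η ⁻¹) * (η * η)        ≤⟨ *-monoˡ-≤ (*-nonneg 0≤η 0≤η) 1+η⁻²≤k ⟩
          (k · 1#) * (η * η)                  ≤⟨ k·η²≤1 k ⟩
          1#                                  ≈⟨ +-identityˡ 1# ⟨
          0# + 1#                             ∎)) (*-nonneg 0≤η 0≤η)

-- Choice of the rate η for a given ε.

theorem1p1 : ∀ {c ℓ₁ ℓ₂ o e} (K : ArchimedeanOrderedField c ℓ₁ ℓ₂) →
    let open ArchimedeanOrderedField K
        open OnlineUSM K
    in (ε : Carrier) → 0# < ε →
       (Ω : ProbabilitySpace o e) (A : OnlineAlgorithm Ω) → NoPreemption A →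
       ¬ Competitive A (¼ + ε) (λ f → NonNegative f × Submodular f × IsDirectedCut f)
theorem1p1 K ε (0≤ε , 0≉ε) Ω A noPreemption competitive =
  let μ , 0≤μ , μ≉0 , μ≤1 , μ≤ε = truncate in refute μ 0≤μ μ≉0 μ≤1 μ≤ε
  where
  open ArchimedeanOrderedField K
  open OrderedFieldProperties K
  open import Relation.Binary.Reasoning.PartialOrder poset

  -- The minimum of ε and 1: the bound by ε yields `2η≤ε`, and the bound by 1 keeps `η′`
  -- nonnegative.
  truncate : ∃[ μ ] (0# ≤ μ × ¬ μ ≈ 0# × μ ≤ 1# × μ ≤ ε)
  truncate with total ε 1#
  ... | inj₁ ε≤1 = ε , 0≤ε , (λ ε≈0 → 0≉ε (sym ε≈0)) , ε≤1 , ≤-refl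
  ... | inj₂ 1≤ε = 1# , 0≤1 , (λ 1≈0 → 0≉1 (sym 1≈0)) , ≤-refl , 1≤ε

  refute : ∀ μ → 0# ≤ μ → ¬ μ ≈ 0# → μ ≤ 1# → μ ≤ ε → ⊥
  refute μ 0≤μ μ≉0 μ≤1 μ≤ε = HardInstance.contradictory K 0≤η η≉0 η≤1 A noPreemption 2η≤ε competitive
    where
    -- Four copies of η make up μ, so both 2η and η lie below μ, and the arithmetic of `¼` is
    -- reused.
    η = ¼ * μ

    4η≈μ : (η + η) + (η + η) ≈ μ
    4η≈μ = trans (sym (4*≈ η)) (4*¼* μ)

    0≤η : 0# ≤ η
    0≤η = *-nonneg 0≤¼ 0≤μ

    η≉0 : ¬ η ≈ 0#
    η≉0 η≈0 = μ≉0 (trans (sym (4*¼* μ)) (trans (*-congˡ η≈0) (zeroʳ _)))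

    2η≤μ : η + η ≤ μ
    2η≤μ = ≤-trans (x≤x+y (+-nonneg 0≤η 0≤η)) (≤-reflexive 4η≈μ)

    η≤1 : η ≤ 1#
    η≤1 = ≤-trans (x≤x+y 0≤η) (≤-trans 2η≤μ μ≤1)

    2η≤ε : η + η ≤ ε
    2η≤ε = ≤-trans 2η≤μ μ≤ε
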